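{- Let $R$ be an eDCTRS over a signature $\mathcal{F}$ which is $\mathbb{U}_{\mathrm{opt}}$-RL and $\mathbb{U}_{\mathrm{opt}}$-NE, and suppose that $R$ is non-LV or non-RV. Then $\mathbb{U}_{\mathrm{opt}}$ is sound for $R$, i.e., for all $s,t\in T(\mathcal{F},\mathcal{V})$, if $s\to^*_{\mathbb{U}_{\mathrm{opt}}(R)} t$ then $s\to^*_R t$.
   Context: Fix a countably infinite set $\mathcal{V}$ of variables; $T(\mathcal{F},\mathcal{V})$ is the set of terms over $\mathcal{F}$, $\mathrm{Var}(t_1,\dots,t_n)$ the set of variables occurring in the $t_i$. A term is linear if no variable occurs in it twice. An extended conditional rewrite rule over $\mathcal{F}$ is $\rho: l\to r\Leftarrow s_1\twoheadrightarrow t_1;\dots;s_k\twoheadrightarrow t_k$ ($k\ge0$), all terms in $T(\mathcal{F},\mathcal{V})$ ($l$ may be a variable); unconditional if $k=0$. An eCTRS is a set of such rules, an eTRS one with only unconditional rules (extra variables allowed). The rewrite relation of an eCTRS $R$ is $\to_R=\bigcup_n\to_{(n),R}$, $\to_{(0),R}=\emptyset$, $\to_{(i+1),R}=\{(C[l\sigma],C[r\sigma])\mid \text{rule in }R,\ s_j\sigma\to^*_{(i),R}t_j\sigma\text{ for all }j\}$. A rule is deterministic if $\mathrm{Var}(s_i)\subseteq\mathrm{Var}(l,t_1,\dots,t_{i-1})$ for all $i$; an eDCTRS is an eCTRS of deterministic rules. A rule is RL if $r$ is linear, NE if $\mathrm{Var}(l)\subseteq\mathrm{Var}(r)$, non-LV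 if $l\notin\mathcal{V}$, non-RV if $r\notin\mathcal{V}$; an eCTRS has such a property if all its rules do. Optimized unraveling: for a deterministic rule $\rho$ with $k\ge1$ let $X_i=\mathrm{Var}(l,t_1,\dots,t_{i-1})$, $Y_i=\mathrm{Var}(r,t_i,s_{i+1},t_{i+1},\dots,s_k,t_k)$, $Z_i=X_i\cap Y_i$, and $\overrightarrow{X}$ the list of elements of a finite set $X$ in a fixed order. With fresh symbols $U^\rho_1,\dots,U^\rho_k$ not in $\mathcal{F}$, $\mathbb{U}_{\mathrm{opt}}(\rho)=\{l\to U^\rho_1(s_1,\overrightarrow{Z_1})\}\cup\{U^\rho_i(t_i,\overrightarrow{Z_i})\to U^\rho_{i+1}(s_{i+1},\overrightarrow{Z_{i+1}})\mid1\le i<k\}\cup\{U^\rho_k(t_k,\overrightarrow{Z_k})\to r\}$, and $\mathbb{U}_{\mathrm{opt}}(\rho)=\{\rho\}$ if $\rho$ is unconditional; $\mathbb{U}_{\mathrm{opt}}(R)=\bigcup_{\rho\in R}\mathbb{U}_{\mathrm{opt}}(\rho)$. For a rule property P, $\rho$ is $\mathbb{U}_{\mathrm{opt}}$-P if all rules of $\mathbb{U}_{\mathrm{opt}}(\rho)$ have P; an eCTRS is $\mathbb{U}_{\mathrm{opt}}$-P if all its rules are. -}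

module Defs where

open import Data.Nat using (ℕ; zero; suc; _⊔_; _≟_)
open import Data.Fin using (Fin)
open import Data.Vec as V using (Vec; []; _∷_; lookup; _[_]≔_)
open import Data.List as L using (List; []; _∷_; _++_; length; filter; upTo; foldr; take; drop)
open import Data.List.Membership.DecPropositional _≟_ using (_∈?_)
open import Data.List.Membership.Propositional using (_∈_)
open import Data.List.Relation.Binary.Subset.Propositional using (_⊆_)
open import Data.List.Relation.Unary.Unique.Propositional using (Unique)
open import Data.List.Relation.Unary.All using (All)
open import Data.Product using (Σ; ∃; _×_; _,_; proj₁; proj₂)
open import Data.Sum using (_⊎_; inj₁; inj₂)
open import Data.Unit using (⊤)
open import Data.Empty using (⊥)
open import Relation.Nullary using (¬_)
open import Relation.Nullary.Decidable using (_×-dec_)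
open import Relation.Binary.PropositionalEquality using (_≡_)
open import Relation.Binary.Construct.Closure.ReflexiveTransitive using (Star)

record Sig : Set₁ where
  field
    Sym   : Set
    arity : Sym → ℕ
open Sig public

data Term (S : Sig) : Set where
  var : ℕ → Term S
  fun : (f : Sym S) → Vec (Term S) (arity S f) → Term S

Var = ℕ

mutual
  vars : ∀ {S} → Term S → List Var
  vars (var x)    = x ∷ []
  vars (fun f ts) = varsV ts

  varsV : ∀ {S n} → Vec (Term S) n → List Var
  varsV []       = []
  varsV (t ∷ ts) = vars t ++ varsV ts

Subst : Sig → Set
Subst S = Var → Term S

mutual
  _·_ : ∀ {S} → Term S → Subst S → Term S
  var x    · σ = σ x
  fun f ts · σ = fun f (substV ts σ)

  substV : ∀ {S n} → Vec (Term S) n → Subst S → Vec (Term S) n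
  substV []       σ = []
  substV (t ∷ ts) σ = (t · σ) ∷ substV ts σ

Linear : ∀ {S} → Term S → Set
Linear t = Unique (vars t)

IsVar : ∀ {S} → Term S → Set
IsVar t = ∃ λ x → t ≡ var x

record Rule (S : Sig) : Set where
  constructor _⟶_⇐_
  field
    lhs   : Term S
    rhs   : Term S
    conds : List (Term S × Term S)
open Rule public

CTRS : Sig → Set₁
CTRS S = Rule S → Set

Unconditional : ∀ {S} → Rule S → Set
Unconditional ρ = conds ρ ≡ []

varsC : ∀ {S} → List (Term S × Term S) → List Var
varsC []             = []
varsC ((s , t) ∷ cs) = vars s ++ vars t ++ varsC cs

varsT : ∀ {S} → List (Term S × Term S) → List Var
varsT []             = []
varsT ((s , t) ∷ cs) = vars t ++ varsT cs

Rel : Sig → Set₁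
Rel S = Term S → Term S → Set

data CtxClosure {S : Sig} (r : Rel S) : Rel S where
  root : ∀ {s t} → r s t → CtxClosure r s t
  arg  : ∀ (f : Sym S) (ts : Vec (Term S) (arity S f)) (i : Fin (arity S f)) {u} →
         CtxClosure r (lookup ts i) u →
         CtxClosure r (fun f ts) (fun f (ts [ i ]≔ u))

RootStep : ∀ {S} → CTRS S → Rel S → Rel S
RootStep {S} R cond s t =
  Σ (Rule S) λ ρ → R ρ × Σ (Subst S) λ σ →
    (s ≡ lhs ρ · σ) × (t ≡ rhs ρ · σ) ×
    All (λ c → cond (proj₁ c · σ) (proj₂ c · σ)) (conds ρ)

StepN : ∀ {S} → CTRS S → ℕ → Rel S
StepN R zero    s t = ⊥
StepN R (suc n) = CtxClosure (RootStep R (Star (StepN R n)))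

Step : ∀ {S} → CTRS S → Rel S
Step R s t = ∃ λ n → StepN R n s t

Steps : ∀ {S} → CTRS S → Rel S
Steps R = Star (Step R)

detGo : ∀ {S} → List Var → List (Term S × Term S) → Set
detGo X []             = ⊤
detGo X ((s , t) ∷ cs) = (vars s ⊆ X) × detGo (X ++ vars t) cs

Deterministic : ∀ {S} → Rule S → Set
Deterministic ρ = detGo (vars (lhs ρ)) (conds ρ)

RL NE NonLV NonRV : ∀ {S} → Rule S → Set
RL ρ    = Linear (rhs ρ)
NE ρ    = vars (lhs ρ) ⊆ vars (rhs ρ)
NonLV ρ = ¬ IsVar (lhs ρ)
NonRV ρ = ¬ IsVar (rhs ρ)

AllRules : ∀ {S} → (Rule S → Set) → CTRS S → Set
AllRules {S} P R = ∀ (ρ : Rule S) → R ρ → P ρ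

EDCTRS : ∀ {S} → CTRS S → Set
EDCTRS = AllRules Deterministic

-- Z_i (0-based index i, i.e. the paper's Z_{i+1}) as a list in
-- ascending order without duplicates
module _ {F : Sig} where
  maxL : List Var → ℕ
  maxL = foldr _⊔_ 0

  orderedInter : List Var → List Var → List Var
  orderedInter X Y = filter (λ n → (n ∈? X) ×-dec (n ∈? Y)) (upTo (suc (maxL X)))

  Xset : Rule F → ℕ → List Var
  Xset ρ i = vars (lhs ρ) ++ varsT (take i (conds ρ))

  tAt : List (Term F × Term F) → ℕ → List Var
  tAt []             i       = []
  tAt ((s , t) ∷ cs) zero    = vars t
  tAt (c ∷ cs)       (suc i) = tAt cs i

  Yset : Rule F → ℕ → List Var
  Yset ρ i = vars (rhs ρ) ++ tAt (conds ρ) i ++ varsC (drop (suc i) (conds ρ))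

  Zlist : Rule F → ℕ → List Var
  Zlist ρ i = orderedInter (Xset ρ i) (Yset ρ i)

-- extended signature F ∪ { U^ρ_i } (fresh symbols, indexed by rule and
-- 0-based position i; U^ρ_i has arity 1 + |Z_i|)
Ext : Sig → Sig
Ext F = record
  { Sym   = Sym F ⊎ (Rule F × ℕ)
  ; arity = λ { (inj₁ f) → arity F f ; (inj₂ (ρ , i)) → suc (length (Zlist ρ i)) } }

mutual
  emb : ∀ {F} → Term F → Term (Ext F)
  emb (var x)    = var x
  emb (fun f ts) = fun (inj₁ f) (embV ts)

  embV : ∀ {F n} → Vec (Term F) n → Vec (Term (Ext F)) n
  embV []       = []
  embV (t ∷ ts) = emb t ∷ embV ts

embRule : ∀ {F} → Rule F → Rule (Ext F)
embRule (l ⟶ r ⇐ cs) = emb l ⟶ emb r ⇐ L.map (λ c → emb (proj₁ c) , emb (proj₂ c)) cs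

module _ {F : Sig} (ρ : Rule F) where
  U : ℕ → Term (Ext F) → Term (Ext F)
  U i u = fun (inj₂ (ρ , i)) (u ∷ V.map var (V.fromList (Zlist ρ i)))

  chain : ℕ → List (Term F × Term F) → List (Rule (Ext F))
  chain i []                         = []
  chain i ((s , t) ∷ [])             = (U i (emb t) ⟶ emb (rhs ρ) ⇐ []) ∷ []
  chain i ((s , t) ∷ (s′ , t′) ∷ cs) =
    (U i (emb t) ⟶ U (suc i) (emb s′) ⇐ []) ∷ chain (suc i) ((s′ , t′) ∷ cs)

  Uopt-rule : List (Rule (Ext F))
  Uopt-rule with conds ρ
  ... | []                = embRule ρ ∷ []
  ... | (s , t) ∷ cs      = (emb (lhs ρ) ⟶ U 0 (emb s) ⇐ []) ∷ chain 0 ((s , t) ∷ cs)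

Uopt : ∀ {F} → CTRS F → CTRS (Ext F)
Uopt {F} R ρ′ = Σ (Rule F) λ ρ → R ρ × ρ′ ∈ Uopt-rule ρ

Uopt-P : ∀ {F} → (∀ {S} → Rule S → Set) → Rule F → Set
Uopt-P P ρ = All P (Uopt-rule ρ)

{-# OPTIONS --safe #-}

-- Read backwards, the rules of Uopt(R) form a left-linear system without extra
-- variables: right-linearity makes every right-hand side a linear pattern, and
-- non-erasure means that matching it binds all variables of the left-hand side.
-- So a derivation into an F-term a can be followed backwards while maintaining an
-- invariant a ⊒ u, which resolves every U-symbol of u lazily: a ⊒ U_i(u, zs) records
-- a substitution σ with rσ →* a for which the conditions after the i-th hold, and
-- asks that t_i σ ⊒ u and Z_i σ ⊒ zs.  Undoing the i-th condition only rebinds variables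
-- of s_i; by linearity of U_i(s_i, Z_i) they do not occur in Y_i, so everything
-- recorded so far is unaffected.
module Submission where

open import Defs
open import Data.Sum using (_⊎_; inj₁; inj₂)
open import Data.Nat using (zero; suc; _≤_; _⊔_; s≤s; _≟_)
open import Data.Nat.Properties using (≤-trans; m≤m⊔n; m≤n⊔m)
open import Data.Fin using (zero; suc)
open import Data.Vec as V using (Vec; []; _∷_; lookup; _[_]≔_)
open import Data.Vec.Relation.Binary.Pointwise.Inductive using (Pointwise; []; _∷_)
open import Data.List using (List; []; _∷_; _++_; drop; take)
open import Data.List.Properties using (++-assoc)
open import Data.List.Membership.DecPropositional _≟_ using (_∈?_)
open import Data.List.Membership.Propositional using (_∈_)
open import Data.List.Membership.Propositional.Properties
  using (∈-++⁺ˡ; ∈-++⁺ʳ; ∈-++⁻; ∈-filter⁺; ∈-upTo⁺)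
open import Data.List.Relation.Binary.Disjoint.Propositional using (Disjoint)
open import Data.List.Relation.Binary.Subset.Propositional using (_⊆_)
open import Data.List.Relation.Unary.All as All using (All; []; _∷_)
import Data.List.Relation.Unary.All.Properties as All
open import Data.List.Relation.Unary.AllPairs using ([]; _∷_)
open import Data.List.Relation.Unary.Any using (here; there)
open import Data.List.Relation.Unary.Unique.Propositional using (Unique)
open import Data.Product using (∃; _×_; _,_; proj₁; proj₂)
open import Function using (_∘_)
open import Relation.Nullary using (yes; no; contradiction)
open import Relation.Nullary.Decidable using (_×-dec_)
open import Relation.Binary.PropositionalEquality
  using (_≡_; refl; sym; trans; cong; cong₂; subst; subst₂)
open import Relation.Binary.Construct.Closure.ReflexiveTransitive as Star
  using (Star; ε; _◅_; _◅◅_)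

-- Lists, vectors and substitutions.

Unique-++⁻ : ∀ {A : Set} (xs : List A) {ys} →
  Unique (xs ++ ys) → Unique xs × Unique ys × Disjoint xs ys
Unique-++⁻ []       u         = [] , u , λ { (() , _) }
Unique-++⁻ (x ∷ xs) (x∉ ∷ u) with Unique-++⁻ xs u | All.++⁻ xs x∉
... | uxs , uys , dis | x∉xs , x∉ys =
  x∉xs ∷ uxs , uys , λ { (here refl , q) → All.lookup x∉ys q refl
                       ; (there p , q) → dis (p , q) }

drop-suc : ∀ {A : Set} i (xs : List A) {y ys} → drop i xs ≡ y ∷ ys → drop (suc i) xs ≡ ys
drop-suc zero    (_ ∷ _)  refl = refl
drop-suc (suc i) (_ ∷ xs) eq   = drop-suc i xs eq

-- For undoing a rewrite step inside argument `i`: only that component has to be pulled back.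
Pointwise-[]≔⁻ : ∀ {A B : Set} {_~_ : A → B → Set} {n} {xs : Vec A n} (ys : Vec B n) i {y} →
  (∀ {x} → x ~ y → x ~ lookup ys i) →
  Pointwise _~_ xs (ys [ i ]≔ y) → Pointwise _~_ xs ys
Pointwise-[]≔⁻ (_ ∷ ys) zero    h (p ∷ ps) = h p ∷ ps
Pointwise-[]≔⁻ (_ ∷ ys) (suc i) h (p ∷ ps) = p ∷ Pointwise-[]≔⁻ ys i h ps

module _ {S : Sig} where

  mutual
    subst-cong : (t : Term S) {σ τ : Subst S} →
      (∀ {x} → x ∈ vars t → σ x ≡ τ x) → t · σ ≡ t · τ
    subst-cong (var x)    eq = eq (here refl)
    subst-cong (fun f ts) eq = cong (fun f) (substV-cong ts eq)

    substV-cong : ∀ {n} (ts : Vec (Term S) n) {σ τ : Subst S} →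
      (∀ {x} → x ∈ varsV ts → σ x ≡ τ x) → substV ts σ ≡ substV ts τ
    substV-cong []       eq = refl
    substV-cong (t ∷ ts) eq =
      cong₂ _∷_ (subst-cong t (eq ∘ ∈-++⁺ˡ)) (substV-cong ts (eq ∘ ∈-++⁺ʳ (vars t)))

  merge : List Var → Subst S → Subst S → Subst S
  merge xs θ σ x with x ∈? xs
  ... | yes _ = θ x
  ... | no  _ = σ x

  merge-in : ∀ {xs} {θ σ : Subst S} {x} → x ∈ xs → merge xs θ σ x ≡ θ x
  merge-in {xs} {x = x} x∈ with x ∈? xs
  ... | yes _ = refl
  ... | no ∉  = contradiction x∈ ∉

  merge-out : ∀ {xs ys} {θ σ : Subst S} → Disjoint xs ys →
    ∀ {x} → x ∈ ys → merge xs θ σ x ≡ σ x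
  merge-out {xs} dis {x} x∈ys with x ∈? xs
  ... | yes x∈xs = contradiction (x∈xs , x∈ys) dis
  ... | no  _    = refl

  CtxClosure-map : ∀ {r r′ : Rel S} → (∀ {s t} → r s t → r′ s t) →
    ∀ {s t} → CtxClosure r s t → CtxClosure r′ s t
  CtxClosure-map h (root p)       = root (h p)
  CtxClosure-map h (arg f ts i p) = arg f ts i (CtxClosure-map h p)

varsV-var : ∀ {S} zs → varsV {S} (V.map var (V.fromList zs)) ≡ zs
varsV-var []       = refl
varsV-var (z ∷ zs) = cong (z ∷_) (varsV-var zs)

-- Variables of embedded terms, and the sets X_i, Y_i and Z_i.

module _ {F : Sig} where

  mutual
    vars-emb : (t : Term F) → vars (emb t) ≡ vars t
    vars-emb (var x)    = refl
    vars-emb (fun f ts) = varsV-emb ts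

    varsV-emb : ∀ {n} (ts : Vec (Term F) n) → varsV (embV ts) ≡ varsV ts
    varsV-emb []       = refl
    varsV-emb (t ∷ ts) = cong₂ _++_ (vars-emb t) (varsV-emb ts)

  vars-U : ∀ (ρ : Rule F) i t → vars (U ρ i (emb t)) ≡ vars t ++ Zlist ρ i
  vars-U ρ i t = cong₂ _++_ (vars-emb t) (varsV-var (Zlist ρ i))

  ∈⇒≤maxL : ∀ {x} {X : List Var} → x ∈ X → x ≤ maxL {F} X
  ∈⇒≤maxL {X = y ∷ X} (here refl) = m≤m⊔n y _
  ∈⇒≤maxL {X = y ∷ X} (there x∈)  = ≤-trans (∈⇒≤maxL x∈) (m≤n⊔m y _)

  ∈-Zlist⁺ : ∀ (ρ : Rule F) i {x} → x ∈ Xset ρ i → x ∈ Yset ρ i → x ∈ Zlist ρ i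
  ∈-Zlist⁺ ρ i x∈X x∈Y =
    ∈-filter⁺ (λ n → (n ∈? Xset ρ i) ×-dec (n ∈? Yset ρ i))
      (∈-upTo⁺ (s≤s (∈⇒≤maxL x∈X))) (x∈X , x∈Y)

  tAt-drop : ∀ i (cs : List (Term F × Term F)) {s t cs′} →
    drop i cs ≡ (s , t) ∷ cs′ → tAt cs i ≡ vars t
  tAt-drop zero    (_ ∷ _)  refl = refl
  tAt-drop (suc i) (_ ∷ cs) eq   = tAt-drop i cs eq

  Yset-drop : ∀ (ρ : Rule F) i {s t cs} → drop i (conds ρ) ≡ (s , t) ∷ cs →
    Yset ρ i ≡ vars (rhs ρ) ++ vars t ++ varsC cs
  Yset-drop ρ i eq = cong (vars (rhs ρ) ++_)
    (cong₂ _++_ (tAt-drop i (conds ρ) eq) (cong varsC (drop-suc i (conds ρ) eq)))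

  -- The starting set `X` is arbitrary because `detGo` enlarges it by one `vars t` per condition.
  -- For `X = vars (lhs ρ)` the bound is `Xset ρ i`.
  detGo-drop : ∀ i X (cs : List (Term F × Term F)) {s t cs′} → detGo X cs →
    drop i cs ≡ (s , t) ∷ cs′ → vars s ⊆ X ++ varsT (take i cs)
  detGo-drop zero    X (_ ∷ _)        (s⊆ , _)  refl x∈ = ∈-++⁺ˡ (s⊆ x∈)
  detGo-drop (suc i) X ((_ , t) ∷ cs) (_ , det) eq   x∈ =
    subst (_ ∈_) (++-assoc X (vars t) _) (detGo-drop i (X ++ vars t) cs det eq x∈)

-- Rewriting with `R`: levels and contexts.

module _ {F : Sig} (R : CTRS F) where

  StepN-mono : ∀ {m n} → m ≤ n → ∀ {s t} → StepN R m s t → StepN R n s t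
  StepN-mono (s≤s m≤n) = CtxClosure-map λ (ρ , Rρ , σ , s≡ , t≡ , cs) →
    ρ , Rρ , σ , s≡ , t≡ , All.map (Star.map (StepN-mono m≤n)) cs

  -- A rule applies only when all its conditions hold at one common level, whereas every step of
  -- `Steps R` comes with its own. Monotonicity allows passing to the maximum.
  Steps-level : ∀ {s t} → Steps R s t → ∃ λ n → Star (StepN R n) s t
  Steps-level ε = 0 , ε
  Steps-level ((m , st) ◅ sts) with Steps-level sts
  ... | n , sts′ = m ⊔ n , StepN-mono (m≤m⊔n m n) st ◅ Star.map (StepN-mono (m≤n⊔m m n)) sts′

  Satisfies : Subst F → Term F × Term F → Set
  Satisfies σ (s , t) = Steps R (s · σ) (t · σ)

  Satisfies-level : ∀ {σ cs} → All (Satisfies σ) cs →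
    ∃ λ n → All (λ c → Star (StepN R n) (proj₁ c · σ) (proj₂ c · σ)) cs
  Satisfies-level [] = 0 , []
  Satisfies-level (c ∷ cs) with Steps-level c | Satisfies-level cs
  ... | m , c′ | n , cs′ = m ⊔ n ,
    Star.map (StepN-mono (m≤m⊔n m n)) c′ ∷ All.map (Star.map (StepN-mono (m≤n⊔m m n))) cs′

  rule-step : ∀ {ρ σ} → R ρ → All (Satisfies σ) (conds ρ) → Step R (lhs ρ · σ) (rhs ρ · σ)
  rule-step {ρ} {σ} Rρ cs with Satisfies-level cs
  ... | n , cs′ = suc n , root (ρ , Rρ , σ , refl , refl , cs′)

  Satisfies-cong : ∀ {σ τ} cs → (∀ {x} → x ∈ varsC cs → σ x ≡ τ x) →
    All (Satisfies σ) cs → All (Satisfies τ) cs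
  Satisfies-cong []             eq []       = []
  Satisfies-cong ((s , t) ∷ cs) eq (p ∷ ps) =
    subst₂ (Steps R) (subst-cong s (eq ∘ ∈-++⁺ˡ))
                     (subst-cong t (eq ∘ ∈-++⁺ʳ (vars s) ∘ ∈-++⁺ˡ)) p
    ∷ Satisfies-cong cs (eq ∘ ∈-++⁺ʳ (vars s) ∘ ∈-++⁺ʳ (vars t)) ps

  Step-arg : ∀ f (ts : Vec (Term F) (arity F f)) i {u} →
    Step R (lookup ts i) u → Step R (fun f ts) (fun f (ts [ i ]≔ u))
  Step-arg f ts i (suc n , st) = suc n , arg f ts i st

  -- Lets the reductions of separate arguments be concatenated on the level of vectors before
  -- `fun f` is put around them.
  VecStep : ∀ {n} → Vec (Term F) n → Vec (Term F) n → Set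
  VecStep ts us = ∃ λ i → ∃ λ u → Step R (lookup ts i) u × us ≡ ts [ i ]≔ u

  Pointwise⇒VecSteps : ∀ {n} {ts us : Vec (Term F) n} →
    Pointwise (Steps R) ts us → Star VecStep ts us
  Pointwise⇒VecSteps [] = ε
  Pointwise⇒VecSteps {ts = _ ∷ ts} {u ∷ _} (p ∷ ps) =
    Star.gmap (_∷ ts) (λ st → zero , _ , st , refl) p ◅◅
    Star.gmap (u ∷_) (λ { (i , v , st , refl) → suc i , v , st , refl }) (Pointwise⇒VecSteps ps)

  Steps-fun : ∀ f {ts us} → Pointwise (Steps R) ts us → Steps R (fun f ts) (fun f us)
  Steps-fun f ps =
    Star.gmap (fun f) (λ { {ts} (i , _ , st , refl) → Step-arg f ts i st }) (Pointwise⇒VecSteps ps)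

  -- The invariant.

  infix 4 _⊒_

  -- Read `a ⊒ u` as: `a` is reachable from an F-term that `u` stands for. Each constructor carries
  -- a reduction ending in `a`, so `⊒-Steps` only has to lengthen it. In `stuck` the condition
  -- `(s , t)` itself is left open: the first component of `us` is a state of its evaluation, which
  -- still has to end in `t · σ`.
  data _⊒_ : Term F → Term (Ext F) → Set where
    var   : ∀ {a x} → Steps R (var x) a → a ⊒ var x
    fun   : ∀ {a f as us} → Steps R (fun f as) a → Pointwise _⊒_ as us → a ⊒ fun (inj₁ f) us
    stuck : ∀ {a ρ i s t cs us} (σ : Subst F) →
      drop i (conds ρ) ≡ (s , t) ∷ cs →
      Steps R (rhs ρ · σ) a →
      All (Satisfies σ) cs →
      Pointwise _⊒_ (t · σ ∷ V.map σ (V.fromList (Zlist ρ i))) us →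
      a ⊒ fun (inj₂ (ρ , i)) us

  ⊒-Steps : ∀ {a b u} → a ⊒ u → Steps R a b → b ⊒ u
  ⊒-Steps (var p)                 sts = var (p ◅◅ sts)
  ⊒-Steps (fun p as⊒)             sts = fun (p ◅◅ sts) as⊒
  ⊒-Steps (stuck σ eq p cs as⊒)  sts = stuck σ eq (p ◅◅ sts) cs as⊒

  mutual
    ⊒-refl : ∀ t → t ⊒ emb t
    ⊒-refl (var x)    = var ε
    ⊒-refl (fun f ts) = fun ε (⊒-reflV ts)

    ⊒-reflV : ∀ {n} (ts : Vec (Term F) n) → Pointwise _⊒_ ts (embV ts)
    ⊒-reflV []       = []
    ⊒-reflV (t ∷ ts) = ⊒-refl t ∷ ⊒-reflV ts

  mutual
    -- An embedded term contains no U-symbol, so `stuck` cannot occur and the recorded reductions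
    -- compose, innermost first.
    ⊒⇒Steps : ∀ {a} t → a ⊒ emb t → Steps R t a
    ⊒⇒Steps (var x)    (var p)     = p
    ⊒⇒Steps (fun f ts) (fun p as⊒) = Steps-fun f (⊒⇒StepsV ts as⊒) ◅◅ p

    ⊒⇒StepsV : ∀ {n} {as : Vec (Term F) n} (ts : Vec (Term F) n) →
      Pointwise _⊒_ as (embV ts) → Pointwise (Steps R) ts as
    ⊒⇒StepsV []       []          = []
    ⊒⇒StepsV (t ∷ ts) (a⊒ ∷ as⊒) = ⊒⇒Steps t a⊒ ∷ ⊒⇒StepsV ts as⊒

  -- Substitution and matching under the invariant.

  Related : List Var → Subst F → Subst (Ext F) → Set
  Related xs σ τ = ∀ {x} → x ∈ xs → σ x ⊒ τ x

  mutual
    ⊒-subst : ∀ t {σ τ} → Related (vars t) σ τ → t · σ ⊒ emb t · τ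
    ⊒-subst (var x)    rel = rel (here refl)
    ⊒-subst (fun f ts) rel = fun ε (⊒-substV ts rel)

    ⊒-substV : ∀ {n} (ts : Vec (Term F) n) {σ τ} → Related (varsV ts) σ τ →
      Pointwise _⊒_ (substV ts σ) (substV (embV ts) τ)
    ⊒-substV []       rel = []
    ⊒-substV (t ∷ ts) rel = ⊒-subst t (rel ∘ ∈-++⁺ˡ) ∷ ⊒-substV ts (rel ∘ ∈-++⁺ʳ (vars t))

  ⊒-varsV⁺ : ∀ zs {σ τ} → Related zs σ τ →
    Pointwise _⊒_ (V.map σ (V.fromList zs)) (substV (V.map var (V.fromList zs)) τ)
  ⊒-varsV⁺ []       rel = []
  ⊒-varsV⁺ (z ∷ zs) rel = rel (here refl) ∷ ⊒-varsV⁺ zs (rel ∘ there)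

  ⊒-varsV⁻ : ∀ zs {σ τ} →
    Pointwise _⊒_ (V.map σ (V.fromList zs)) (substV (V.map var (V.fromList zs)) τ) →
    Related zs σ τ
  ⊒-varsV⁻ (z ∷ zs) (p ∷ ps) (here refl) = p
  ⊒-varsV⁻ (z ∷ zs) (p ∷ ps) (there z∈)  = ⊒-varsV⁻ zs ps z∈

  merge-Related : ∀ {xs ys θ σ τ} → Disjoint xs ys →
    Related xs θ τ → Related ys σ τ → Related (xs ++ ys) (merge xs θ σ) τ
  merge-Related {xs} dis relˡ relʳ x∈ with ∈-++⁻ xs x∈
  ... | inj₁ x∈xs = subst (_⊒ _) (sym (merge-in x∈xs)) (relˡ x∈xs)
  ... | inj₂ x∈ys = subst (_⊒ _) (sym (merge-out dis x∈ys)) (relʳ x∈ys)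

  mutual
    -- Each occurrence of a variable proposes its own F-term related to the value under `τ`, and two
    -- proposals need not agree. Linearity leaves one proposal per variable, so the substitutions
    -- found for separate arguments can be merged.
    match : ∀ {a τ} t → Linear t → a ⊒ emb t · τ →
      ∃ λ θ → Steps R (t · θ) a × Related (vars t) θ τ
    -- Values outside the matched variables are arbitrary: constantly `a` here, `var` for the empty
    -- vector.
    match {a} (var x) _ a⊒ = (λ _ → a) , ε , λ { (here refl) → a⊒ }
    match (fun f ts) lin (fun p as⊒) =
      let θ , ps , rel = matchV ts lin as⊒ in θ , Steps-fun f ps ◅◅ p , rel

    matchV : ∀ {n} {as : Vec (Term F) n} {τ} (ts : Vec (Term F) n) → Unique (varsV ts) →
      Pointwise _⊒_ as (substV (embV ts) τ) →
      ∃ λ θ → Pointwise (Steps R) (substV ts θ) as × Related (varsV ts) θ τ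
    matchV []       _   []          = var , [] , λ ()
    matchV (t ∷ ts) lin (a⊒ ∷ as⊒) with Unique-++⁻ (vars t) lin
    ... | lint , lints , dis with match t lint a⊒ | matchV ts lints as⊒
    ... | θ₁ , p , rel₁ | θ₂ , ps , rel₂ =
      merge (vars t) θ₁ θ₂ ,
      subst (λ v → Steps R v _) (sym (subst-cong t merge-in)) p ∷
      subst (λ v → Pointwise (Steps R) v _) (sym (substV-cong ts (merge-out dis))) ps ,
      merge-Related dis rel₁ rel₂

  -- Matching `s` against the first argument gives `θ` with a reduction from `s · θ` to `t · σ`.
  -- Overriding `σ` by `θ` on `vars s` turns this into the open condition, and everything else
  -- recorded mentions only variables of Y_i, where `σ` is kept.
  match-U : ∀ {a τ} ρ i {s t cs} → Deterministic ρ → drop i (conds ρ) ≡ (s , t) ∷ cs →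
    Linear (U ρ i (emb s)) → a ⊒ U ρ i (emb s) · τ →
    ∃ λ σ → Steps R (rhs ρ · σ) a × All (Satisfies σ) ((s , t) ∷ cs) ×
            Related (vars (U ρ i (emb s))) σ τ
  match-U {a} {τ} ρ i {s} {t} {cs} det eq lin (stuck σ eq′ p ps (a⊒ ∷ zs⊒))
    -- The condition stored in `stuck` is the given `(s , t)`, since both head `drop i (conds ρ)`.
    with trans (sym eq) eq′
  ... | refl with Unique-++⁻ (vars s) (subst Unique (vars-U ρ i s) lin)
  ... | lins , _ , disZ with match s lins a⊒
  ... | θ , q , rel =
    merge (vars s) θ σ ,
    subst (λ v → Steps R v a)
      (subst-cong (rhs ρ) (sym ∘ merge-out disY ∘ ∈-++⁺ˡ)) p ,
    subst₂ (Steps R) (subst-cong s (sym ∘ merge-in))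
      (subst-cong t (sym ∘ merge-out disY ∘ ∈-++⁺ʳ (vars (rhs ρ)) ∘ ∈-++⁺ˡ)) q ∷
    Satisfies-cong cs
      (sym ∘ merge-out disY ∘ ∈-++⁺ʳ (vars (rhs ρ)) ∘ ∈-++⁺ʳ (vars t)) ps ,
    subst (λ xs → Related xs (merge (vars s) θ σ) τ) (sym (vars-U ρ i s))
      (merge-Related disZ rel (⊒-varsV⁻ (Zlist ρ i) zs⊒))
    where
    disY : Disjoint (vars s) (vars (rhs ρ) ++ vars t ++ varsC cs)
    -- By determinism `vars s` lies in X_i, so a variable also in Y_i would be in Z_i and occur
    -- twice in `U ρ i (emb s)`.
    disY (x∈s , x∈Y) = disZ (x∈s , ∈-Zlist⁺ ρ i (detGo-drop i _ (conds ρ) det eq x∈s)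
      (subst (_ ∈_) (sym (Yset-drop ρ i eq)) x∈Y))

  match-emb : ∀ {a τ} t → Linear (emb t) → a ⊒ emb t · τ →
    ∃ λ θ → Steps R (t · θ) a × Related (vars (emb t)) θ τ
  match-emb {τ = τ} t lin a⊒ with match t (subst Unique (vars-emb t) lin) a⊒
  ... | θ , p , rel = θ , p , subst (λ xs → Related xs θ τ) (sym (vars-emb t)) rel

  ⊒-subst-emb : ∀ t {σ τ} → Related (vars (emb t)) σ τ → t · σ ⊒ emb t · τ
  ⊒-subst-emb t {σ} {τ} rel = ⊒-subst t (subst (λ xs → Related xs σ τ) (vars-emb t) rel)

  -- Undoing rule applications and rewrite steps.

  ⊒-U : ∀ {a τ} ρ i {s t cs} σ → drop i (conds ρ) ≡ (s , t) ∷ cs →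
    Steps R (rhs ρ · σ) a → All (Satisfies σ) cs → Related (vars (U ρ i (emb t))) σ τ →
    a ⊒ U ρ i (emb t) · τ
  ⊒-U {τ = τ} ρ i {t = t} σ eq p cs rel =
    stuck σ eq p cs (⊒-subst t (rel′ ∘ ∈-++⁺ˡ) ∷ ⊒-varsV⁺ (Zlist ρ i) (rel′ ∘ ∈-++⁺ʳ (vars t)))
    where
    rel′ : Related (vars t ++ Zlist ρ i) σ τ
    rel′ = subst (λ xs → Related xs σ τ) (vars-U ρ i t) rel

  ⊒-chain : ∀ {a τ ρ} i cs {ρ′} → Deterministic ρ → drop i (conds ρ) ≡ cs →
    ρ′ ∈ chain ρ i cs → RL ρ′ → NE ρ′ → a ⊒ rhs ρ′ · τ → a ⊒ lhs ρ′ · τ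
  ⊒-chain {ρ = ρ} i ((s , t) ∷ []) det eq (here refl) rl ne a⊒
    with match-emb (rhs ρ) rl a⊒
  -- Undoing the last rule creates the record: `σ` comes from matching `rhs ρ`, and no condition
  -- follows the last one.
  ... | σ , p , rel = ⊒-U ρ i σ eq p [] (rel ∘ ne)
  ⊒-chain {ρ = ρ} i ((s , t) ∷ c ∷ cs) det eq (here refl) rl ne a⊒
    -- Here `ps` covers the conditions from index `suc i` on, exactly those that `stuck` at index
    -- `i` asks for.
    with match-U ρ (suc i) det (drop-suc i (conds ρ) eq) rl a⊒
  ... | σ , p , ps , rel = ⊒-U ρ i σ eq p ps (rel ∘ ne)
  ⊒-chain {ρ = ρ} i ((s , t) ∷ c ∷ cs) det eq (there ρ′∈) =
    ⊒-chain (suc i) (c ∷ cs) det (drop-suc i (conds ρ) eq) ρ′∈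

  -- At the rule with left-hand side `emb l` the record is cashed in: once condition 0 is undone all
  -- conditions hold for `σ`, so a genuine step of `R` from `l · σ` can be put in front of the
  -- recorded reduction to `a`.
  ⊒-rule : ∀ {a τ ρ ρ′} → R ρ → Deterministic ρ → ρ′ ∈ Uopt-rule ρ → RL ρ′ → NE ρ′ →
    a ⊒ rhs ρ′ · τ → a ⊒ lhs ρ′ · τ
  ⊒-rule {ρ = l ⟶ r ⇐ []} Rρ det (here refl) rl ne a⊒ with match-emb r rl a⊒
  ... | σ , p , rel = ⊒-Steps (⊒-subst-emb l (rel ∘ ne)) (rule-step Rρ [] ◅ p)
  ⊒-rule {ρ = ρ@(l ⟶ r ⇐ (_ ∷ _))} Rρ det (here refl) rl ne a⊒
    with match-U ρ 0 det refl rl a⊒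
  ... | σ , p , ps , rel = ⊒-Steps (⊒-subst-emb l (rel ∘ ne)) (rule-step Rρ ps ◅ p)
  ⊒-rule {ρ = l ⟶ r ⇐ (c ∷ cs)} Rρ det (there ρ′∈) = ⊒-chain 0 (c ∷ cs) det refl ρ′∈

  -- Inside an argument the target is no longer `a` but the recorded component, which is why the
  -- hypothesis covers every `a`. A step below a U-symbol leaves `σ` and its reductions untouched.
  ⊒-CtxClosure : ∀ {r : Rel (Ext F)} → (∀ {a u v} → r u v → a ⊒ v → a ⊒ u) →
    ∀ {a u v} → CtxClosure r u v → a ⊒ v → a ⊒ u
  ⊒-CtxClosure h (root p) a⊒ = h p a⊒
  ⊒-CtxClosure h (arg (inj₁ f) ts i st) (fun p as⊒) =
    fun p (Pointwise-[]≔⁻ ts i (⊒-CtxClosure h st) as⊒)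
  ⊒-CtxClosure h (arg (inj₂ _) ts i st) (stuck σ eq p cs as⊒) =
    stuck σ eq p cs (Pointwise-[]≔⁻ ts i (⊒-CtxClosure h st) as⊒)

  module _ (det : EDCTRS R) (rl : AllRules (Uopt-P RL) R) (ne : AllRules (Uopt-P NE) R) where

    ⊒-Step : ∀ {a u v} → Step (Uopt R) u v → a ⊒ v → a ⊒ u
    ⊒-Step (suc n , st) = ⊒-CtxClosure
      (λ { (ρ′ , (ρ , Rρ , ρ′∈) , τ , refl , refl , _) →
           ⊒-rule Rρ (det ρ Rρ) ρ′∈ (All.lookup (rl ρ Rρ) ρ′∈) (All.lookup (ne ρ Rρ) ρ′∈) })
      st

    ⊒-Uopt-Steps : ∀ {a u v} → Steps (Uopt R) u v → a ⊒ v → a ⊒ u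
    ⊒-Uopt-Steps ε          a⊒ = a⊒
    ⊒-Uopt-Steps (st ◅ sts) a⊒ = ⊒-Step st (⊒-Uopt-Steps sts a⊒)

theorem4p9 : (F : Sig) (R : CTRS F) →
    EDCTRS R →
    AllRules (Uopt-P RL) R →
    AllRules (Uopt-P NE) R →
    (AllRules NonLV R ⊎ AllRules NonRV R) →
    ∀ (s t : Term F) → Steps (Uopt R) (emb s) (emb t) → Steps R s t
theorem4p9 F R det rl ne _ s t sts =
  -- The target stays `t` throughout: the backward pass leads from `t ⊒ emb t` to `t ⊒ emb s`.
  ⊒⇒Steps R s (⊒-Uopt-Steps R det rl ne sts (⊒-refl R t))
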